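{- Let $n\ge 0$ and $j,k\ge 0$ be integers. The number of permutations $\pi$ of $[n]=\{1,\dots,n\}$ that avoid the barred pattern $\overline{3}\overline{1}542$ and have exactly $j+k$ left-to-right maxima, of which exactly $j$ initiate a descent in $\pi$ and exactly $k$ do not, equals $$\binom{n}{k}\, j!\, \left\{ {n-j-k \atop j} \right\},$$ where $\left\{ {m \atop j} \right\}$ denotes the Stirling number of the second kind.
   Context: A permutation $\pi=\pi(1)\cdots\pi(n)$ of $[n]$ avoids the barred pattern $\overline{3}\overline{1}542$ if every occurrence of the pattern $542$ extends to an occurrence of $31542$; explicitly: for all indices $a<b<c$ with $\pi(a)>\pi(b)>\pi(c)$ there exist indices $d<e<a$ with $\pi(e)<\pi(c)<\pi(d)<\pi(b)$. An entry $\pi(i)$ is a left-to-right maximum if $\pi(i)>\pi(h)$ for all $h<i$. A left-to-right maximum $\pi(i)$ initiates a descent if $i<n$ and $\pi(i)>\pi(i+1)$. The Stirling number of the second kind $\left\{ {m \atop j} \right\}$ is the number of partitions of an $m$-element set into $j$ nonempty blocks, with $\left\{ {0 \atop 0} \right\}=1$ and $\left\{ {m \atop j} \right\}=0$ when $m<0$; also $\binom{n}{k}=0$ for $k>n$. -}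

module Defs where

open import Data.Nat using (ℕ; zero; suc; _+_; _*_; _∸_; _≤ᵇ_)
open import Data.Bool using (if_then_else_)
open import Data.Fin using (Fin; toℕ) renaming (_<_ to _<ᶠ_; _<?_ to _<ᶠ?_)
open import Data.Fin.Properties using (all?; any?; _≟_)
open import Data.Vec using (Vec; []; _∷_; lookup)
open import Data.List using (List; []; _∷_; length; filter; concatMap; map)
open import Data.Product using (_×_; _,_; ∃)
open import Relation.Nullary using (Dec; yes; no; ¬_)
open import Relation.Nullary.Decidable using (_×-dec_; _→-dec_; ¬?)
open import Relation.Binary.PropositionalEquality using (_≡_)

stirling2 : ℕ → ℕ → ℕ
stirling2 zero    zero    = 1
stirling2 zero    (suc j) = 0
stirling2 (suc m) zero    = 0
stirling2 (suc m) (suc j) = suc j * stirling2 m (suc j) + stirling2 m j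

allWords : ∀ (m n : ℕ) → List (Vec (Fin n) m)
allWords zero    n = [] ∷ []
allWords (suc m) n = concatMap (λ w → map (λ x → x ∷ w) (Data.List.Base.tabulate {n = n} (λ i → i))) (allWords m n)
  where import Data.List.Base

IsPerm : ∀ {n} → Vec (Fin n) n → Set
IsPerm {n} π = ∀ (a b : Fin n) → lookup π a ≡ lookup π b → a ≡ b

isPerm? : ∀ {n} (π : Vec (Fin n) n) → Dec (IsPerm π)
isPerm? π = all? λ a → all? λ b → (lookup π a ≟ lookup π b) →-dec (a ≟ b)

Avoids31542 : ∀ {n} → Vec (Fin n) n → Set
Avoids31542 {n} π =
  ∀ (a b c : Fin n) → a <ᶠ b → b <ᶠ c →
    lookup π b <ᶠ lookup π a → lookup π c <ᶠ lookup π b →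
    ∃ λ (d : Fin n) → ∃ λ (e : Fin n) →
      d <ᶠ e × e <ᶠ a × lookup π e <ᶠ lookup π c ×
      lookup π c <ᶠ lookup π d × lookup π d <ᶠ lookup π b

avoids31542? : ∀ {n} (π : Vec (Fin n) n) → Dec (Avoids31542 π)
avoids31542? π =
  all? λ a → all? λ b → all? λ c →
    (a <ᶠ? b) →-dec ((b <ᶠ? c) →-dec ((lookup π b <ᶠ? lookup π a) →-dec
      ((lookup π c <ᶠ? lookup π b) →-dec
        (any? λ d → any? λ e →
          (d <ᶠ? e) ×-dec ((e <ᶠ? a) ×-dec ((lookup π e <ᶠ? lookup π c) ×-dec
            ((lookup π c <ᶠ? lookup π d) ×-dec (lookup π d <ᶠ? lookup π b))))))))

IsLRMax : ∀ {n} → Vec (Fin n) n → Fin n → Set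
IsLRMax {n} π i = ∀ (h : Fin n) → h <ᶠ i → lookup π h <ᶠ lookup π i

isLRMax? : ∀ {n} (π : Vec (Fin n) n) (i : Fin n) → Dec (IsLRMax π i)
isLRMax? π i = all? λ h → (h <ᶠ? i) →-dec (lookup π h <ᶠ? lookup π i)

InitiatesDescent : ∀ {n} → Vec (Fin n) n → Fin n → Set
InitiatesDescent {n} π i =
  ∃ λ (i' : Fin n) → toℕ i' ≡ suc (toℕ i) × lookup π i' <ᶠ lookup π i

initiatesDescent? : ∀ {n} (π : Vec (Fin n) n) (i : Fin n) → Dec (InitiatesDescent π i)
initiatesDescent? π i =
  any? λ i' → (toℕ i' Data.Nat.≟ suc (toℕ i)) ×-dec (lookup π i' <ᶠ? lookup π i)
  where import Data.Nat

lrmaxDesc : ∀ {n} → Vec (Fin n) n → ℕ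
lrmaxDesc {n} π =
  length (filter (λ i → isLRMax? π i ×-dec initiatesDescent? π i)
                 (Data.List.Base.allFin n))
  where import Data.List.Base

lrmaxNonDesc : ∀ {n} → Vec (Fin n) n → ℕ
lrmaxNonDesc {n} π =
  length (filter (λ i → isLRMax? π i ×-dec ¬? (initiatesDescent? π i))
                 (Data.List.Base.allFin n))
  where import Data.List.Base

lrmax : ∀ {n} → Vec (Fin n) n → ℕ
lrmax {n} π = length (filter (isLRMax? π) (Data.List.Base.allFin n))
  where import Data.List.Base

Counted : ∀ (n j k : ℕ) → Vec (Fin n) n → Set
Counted n j k π =
  IsPerm π × Avoids31542 π × lrmax π ≡ j + k ×
  lrmaxDesc π ≡ j × lrmaxNonDesc π ≡ k

counted? : ∀ (n j k : ℕ) (π : Vec (Fin n) n) → Dec (Counted n j k π)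
counted? n j k π =
  isPerm? π ×-dec (avoids31542? π ×-dec ((lrmax π Data.Nat.≟ j + k) ×-dec
    ((lrmaxDesc π Data.Nat.≟ j) ×-dec (lrmaxNonDesc π Data.Nat.≟ k))))
  where import Data.Nat

countPerms : ℕ → ℕ → ℕ → ℕ
countPerms n j k = length (filter (counted? n j k) (allWords n n))

stirlingGuarded : ℕ → ℕ → ℕ → ℕ
stirlingGuarded n j k = if (j + k) ≤ᵇ n then stirling2 (n ∸ j ∸ k) j else 0

{-# OPTIONS --safe #-}
module Submission where

open import Defs
open import Data.Nat as ℕ using (ℕ; zero; suc; _+_; _*_; _∸_; _≤ᵇ_; _!)
import Data.Nat.Properties as ℕ
open import Data.Nat.Combinatorics using (_C_; nC1≡n; nCk+nC[k+1]≡[n+1]C[k+1])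
open import Data.Nat.Induction using (<-wellFounded)
open import Data.Nat.Tactic.RingSolver using (solve-∀)
open import Data.Bool using (if_then_else_)
open import Data.Empty using (⊥; ⊥-elim)
open import Data.Fin using (Fin; zero; suc; toℕ; fromℕ; fromℕ<; inject₁; lower₁; punchIn; punchOut; _<_; _≤_; _<?_; _≤?_)
open import Data.Fin.Properties as Fin using (all?; any?; punchIn-punchOut; punchIn-injective; punchInᵢ≢i; punchIn-mono-≤; punchIn-cancel-≤)
open import Data.List using (List; []; _∷_; _++_; length; filter; map; allFin; concatMap)
open import Data.List.Properties using (length-++; length-tabulate)
open import Data.List.Membership.Propositional using (_∈_; lose; find)
open import Data.List.Membership.Propositional.Properties
open import Data.List.Membership.Propositional.Properties.WithK using (unique∧set⇒bag)
open import Data.List.Relation.Binary.BagAndSetEquality using (∼bag⇒↭)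
open import Data.List.Relation.Binary.Permutation.Propositional.Properties using (↭-length)
open import Data.List.Relation.Unary.All as All using (All)
open import Data.List.Relation.Unary.AllPairs using ([]; _∷_)
open import Data.List.Relation.Unary.Any using (here; there)
open import Data.List.Relation.Unary.Unique.Propositional using (Unique)
import Data.List.Relation.Unary.Unique.Propositional.Properties as Uniq
open import Data.Product using (_×_; _,_; ∃; proj₁; proj₂)
open import Data.Sum using (_⊎_; inj₁; inj₂; [_,_])
open import Data.Unit using (⊤; tt)
open import Data.Vec as Vec using (Vec; []; _∷_; lookup; tabulate; insertAt)
open import Data.Vec.Properties using (lookup∘tabulate; tabulate∘lookup; tabulate-cong; insertAt-lookup; insertAt-punchIn; lookup-map)
open import Function using (_∘_; id; mk⇔)
open import Induction.WellFounded using (Acc; acc)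
open import Relation.Binary using (Tri; tri<; tri≈; tri>)
open import Relation.Binary.PropositionalEquality using (_≡_; _≢_; refl; sym; trans; cong; cong₂; subst; subst₂; module ≡-Reasoning)
open import Relation.Nullary using (¬_; Dec; yes; no)
open import Relation.Nullary.Decidable using (_×-dec_; _→-dec_; ¬?; decidable-stable)
open import Relation.Unary using (Decidable)

-- Call a left-to-right maximum plain if it does not initiate a descent. A permutation avoids the
-- pattern iff any decreasing triple a > b > c has a descent-initiating maximum with value between
-- b and c. Hence
-- * plain maxima are irrelevant: deleting one leaves the structure intact, and it is recovered from
--   its value v as the entry to be put in front of the first entry exceeding v. Marking one plain
--   maximum gives (k+1) P(n+1,j,k+1) = (n+1) P(n,j,k), which reduces the count to k = 0;
-- * for k = 0 the last entry is the immediate predecessor, in value, of one of the j maxima, which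
--   can be any of them. Deleting it may leave at most a plain maximum in last position, so
--   P(n+2,j+1,0) = (j+1) (P(n+1,j+1,0) + P(n,j,0)).

private
  variable
    A B : Set
    P Q : A → Set
    m n l j k : ℕ

-- Cardinalities of predicates and bijective counting

-- Cardinality as a relation: any duplicate-free listing of `P` will do, so a size can be
-- transported along a correspondence and then compared with another one by `size-unique`.
record Size {A : Set} (P : A → Set) (m : ℕ) : Set where
  field
    elems    : List A
    unique   : Unique elems
    sound    : ∀ {x} → x ∈ elems → P x
    complete : ∀ {x} → P x → x ∈ elems
    count    : length elems ≡ m

open Size

-- Duplicate-free lists with the same members are permutations of each other. This closes the double
-- counts below.
size-unique : Size P m → Size P l → m ≡ l
size-unique s t = trans (sym (count s)) (trans (↭-length (∼bag⇒↭ (unique∧set⇒bag (unique s) (unique t)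
  (mk⇔ (λ x → complete t (sound s x)) (λ x → complete s (sound t x)))))) (count t))

size-cong : {A : Set} {P Q : A → Set} → (∀ {x} → P x → Q x) → (∀ {x} → Q x → P x) → Size P m → Size Q m
size-cong f g s = record
  { elems = elems s ; unique = unique s ; sound = λ x → f (sound s x)
  ; complete = λ q → complete s (g q) ; count = count s }

size-∅ : (∀ {x} → ¬ P x) → Size P 0
size-∅ ¬p = record
  { elems = [] ; unique = [] ; sound = λ () ; complete = λ p → ⊥-elim (¬p p) ; count = refl }

size-0 : Size P 0 → ∀ {x} → ¬ P x
size-0 record { elems = [] ; complete = c } p with c p
... | ()

size-singleton : ∀ {A : Set} {P : A → Set} {x} → P x → (∀ {y} → P y → x ≡ y) → Size P 1
size-singleton {x = x} p only = record
  { elems = x ∷ [] ; unique = All.[] ∷ [] ; sound = λ { (here refl) → p }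
  ; complete = λ q → here (sym (only q)) ; count = refl }

size-1 : Size P 1 → ∀ {x y} → P x → P y → x ≡ y
size-1 record { elems = _ ∷ [] ; complete = c } p q with c p | c q
... | here refl | here refl = refl

size-⊎ : Size P m → Size Q l → (∀ {x} → P x → ¬ Q x) → Size (λ x → P x ⊎ Q x) (m + l)
size-⊎ s t disjoint = record
  { elems = elems s ++ elems t
  ; unique = Uniq.++⁺ (unique s) (unique t) (λ (x , y) → disjoint (sound s x) (sound t y))
  ; sound = λ x → [ (λ y → inj₁ (sound s y)) , (λ y → inj₂ (sound t y)) ] (∈-++⁻ (elems s) x)
  ; complete = [ (λ p → ∈-++⁺ˡ (complete s p)) , (λ q → ∈-++⁺ʳ (elems s) (complete t q)) ]
  ; count = trans (length-++ (elems s)) (cong₂ _+_ (count s) (count t)) }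

size-filter : (P? : Decidable P) → ∀ {xs} → Unique xs → (∀ x → x ∈ xs) → Size P (length (filter P? xs))
size-filter P? {xs} u all = record
  { elems = filter P? xs ; unique = Uniq.filter⁺ P? u
  ; sound = λ x → proj₂ (∈-filter⁻ P? {xs = xs} x) ; complete = λ {x} p → ∈-filter⁺ P? (all x) p ; count = refl }

size-image : (R : A → B → Set) → ∀ {xs} → Unique xs →
  (∀ {x} → x ∈ xs → ∃ (R x)) →
  (∀ {x y y′} → R x y → R x y′ → y ≡ y′) →
  (∀ {x x′ y} → R x y → R x′ y → x ≡ x′) →
  Size (λ y → ∃ λ x → x ∈ xs × R x y) (length xs)
size-image R {[]} _ _ _ _ = size-∅ λ ()
size-image R {x ∷ xs} (x∉ ∷ u) total functional injective =
  size-cong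
    [ (λ r → x , here refl , r) , (λ (x′ , x′∈ , r) → x′ , there x′∈ , r) ]
    (λ { (_ , here refl , r) → inj₁ r ; (x′ , there x′∈ , r) → inj₂ (x′ , x′∈ , r) })
    (size-⊎ (size-singleton (proj₂ (total (here refl))) (functional (proj₂ (total (here refl)))))
      (size-image R u (λ x∈ → total (there x∈)) functional injective)
      (λ r (_ , x′∈ , r′) → All.lookup x∉ x′∈ (injective r r′)))

-- The bijection is given as a relation, so that inserting and deleting an entry are two readings of
-- the same relation and no inverse function has to be computed.
size-relate : {A B : Set} {P : A → Set} {Q : B → Set} → (R : A → B → Set) → Size P m →
  (∀ {x} → P x → ∃ λ y → Q y × R x y) →
  (∀ {y} → Q y → ∃ λ x → P x × R x y) →
  (∀ {x y y′} → P x → Q y → Q y′ → R x y → R x y′ → y ≡ y′) →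
  (∀ {x x′ y} → P x → P x′ → Q y → R x y → R x′ y → x ≡ x′) →
  Size Q m
size-relate {P = P} {Q = Q} R s to from functional injective =
  subst (Size _) (count s) (size-cong
    (λ (_ , _ , _ , q , _) → q)
    (λ q → let (x , p , r) = from q in x , complete s p , p , q , r)
    (size-image (λ x y → P x × Q y × R x y) (unique s)
      (λ x∈ → let (y , q , r) = to (sound s x∈) in y , sound s x∈ , q , r)
      (λ (p , q , r) (_ , q′ , r′) → functional p q q′ r r′)
      (λ (p , q , r) (p′ , _ , r′) → injective p p′ q r r′)))

size-Σ-∈ : {A B : Set} {l : ℕ} {Q : A → B → Set} → ∀ {xs} → Unique xs → (∀ {x} → x ∈ xs → Size (Q x) l) →
  Size (λ (x , y) → x ∈ xs × Q x y) (length xs * l)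
size-Σ-∈ {xs = []} _ _ = size-∅ λ ()
size-Σ-∈ {A = A} {B = B} {Q = Q} {xs = x ∷ xs} (x∉ ∷ u) fibre =
  size-cong {A = A × B} {P = λ (x′ , y) → (x ≡ x′ × Q x y) ⊎ (x′ ∈ xs × Q x′ y)}
    [ (λ { (refl , q) → here refl , q }) , (λ (x′∈ , q) → there x′∈ , q) ]
    (λ { (here refl , q) → inj₁ (refl , q) ; (there x′∈ , q) → inj₂ (x′∈ , q) })
    (size-⊎
      (size-relate {B = A × B} {Q = λ (x′ , y) → x ≡ x′ × Q x y} (λ y xy → xy ≡ (x , y)) (fibre (here refl))
        (λ q → _ , (refl , q) , refl) (λ { (refl , q) → _ , q , refl })
        (λ { _ _ _ refl refl → refl }) (λ { _ _ _ refl refl → refl }))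
      (size-Σ-∈ u (λ x∈ → fibre (there x∈)))
      (λ { (refl , _) (x∈ , _) → All.lookup x∉ x∈ refl }))

size-Σ : {A B : Set} {P : A → Set} {m l : ℕ} {Q : A → B → Set} → Size P m → (∀ {x} → P x → Size (Q x) l) →
  Size (λ (x , y) → P x × Q x y) (m * l)
size-Σ {A = A} {B = B} {P = P} {l = l} {Q = Q} s fibre = subst (λ c → Size _ (c * l)) (count s) (size-cong
  {A = A × B} {P = λ (x , y) → x ∈ elems s × Q x y} {Q = λ (x , y) → P x × Q x y}
  (λ (x∈ , q) → sound s x∈ , q) (λ (p , q) → complete s p , q)
  (size-Σ-∈ (unique s) (λ x∈ → fibre (sound s x∈))))

size-Fin : ∀ n → Size {Fin n} (λ _ → ⊤) n
size-Fin n = record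
  { elems = allFin n ; unique = Uniq.allFin⁺ n ; sound = λ _ → tt ; complete = λ {i} _ → ∈-allFin i
  ; count = length-tabulate {n = n} id }

-- Finite search and the pigeonhole principle

-- `R` is kept abstract so that one search yields both the first position with a property and the
-- position of a largest value.
extremal : ∀ {n} {P : Fin n → Set} (P? : Decidable P) {R : Fin n → Fin n → Set} →
  (∀ x y → R x y ⊎ R y x) → (∀ {x y z} → R x y → R y z → R x z) →
  ∃ P → ∃ λ i → P i × (∀ h → P h → R i h)
extremal {zero} P? _ _ (() , _)
extremal {suc n} {P} P? {R} total transitive (x , px) with any? (P? ∘ suc)
... | no ¬e = zero , P0 x px , λ where
    zero _ → [ id , id ] (total zero zero)
    (suc h) p → ⊥-elim (¬e (h , p))
  where
  P0 : ∀ x → P x → P zero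
  P0 zero p = p
  P0 (suc x) p = ⊥-elim (¬e (x , p))
... | yes e with extremal (P? ∘ suc) {λ x y → R (suc x) (suc y)} (λ x y → total (suc x) (suc y)) transitive e | P? zero
... | i , pi , least | no ¬p0 = suc i , pi , λ { zero p → ⊥-elim (¬p0 p) ; (suc h) p → least h p }
... | i , pi , least | yes p0 with total zero (suc i)
... | inj₁ r = zero , p0 , λ { zero p → [ id , id ] (total zero zero) ; (suc h) p → transitive r (least h p) }
... | inj₂ r = suc i , pi , λ { zero p → r ; (suc h) p → least h p }

-- Pigeonhole: punching out a missed value would inject `Fin (suc n)` into `Fin n`.
injective⇒surjective : (f : Fin n → Fin n) → (∀ a b → f a ≡ f b → a ≡ b) → ∀ v → ∃ λ i → f i ≡ v
injective⇒surjective {suc n} f inj v with any? (λ i → f i Fin.≟ v)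
... | yes e = e
... | no ¬e = ⊥-elim (ℕ.1+n≰n (Fin.injective⇒≤ {f = λ i → punchOut {i = v} (λ eq → ¬e (i , sym eq))}
  (λ {a} {b} eq → inj a b (Fin.punchOut-injective {i = v} _ _ eq))))

lookup-ext : {A : Set} (xs ys : Vec A n) → (∀ i → lookup xs i ≡ lookup ys i) → xs ≡ ys
lookup-ext xs ys eq = trans (sym (tabulate∘lookup xs)) (trans (tabulate-cong eq) (tabulate∘lookup ys))

-- Descent-initiating and plain maxima; avoidance as separation

-- For a left-to-right maximum i, some later i′ with π i′ < π i ≥ everything before i′ exists iff
-- already the entry after i is smaller; unlike adjacency, this form is stable under deleting entries.
DescentMax : Vec (Fin n) n → Fin n → Set
DescentMax π i = ∃ λ i′ → i < i′ × lookup π i′ < lookup π i × (∀ h → h < i′ → lookup π h ≤ lookup π i)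

PlainMax : Vec (Fin n) n → Fin n → Set
PlainMax π i = IsLRMax π i × ¬ DescentMax π i

descentMax? : (π : Vec (Fin n) n) → Decidable (DescentMax π)
descentMax? π i = any? λ i′ → (i <? i′) ×-dec ((lookup π i′ <? lookup π i) ×-dec
  (all? λ h → (h <? i′) →-dec (lookup π h ≤? lookup π i)))

plainMax? : (π : Vec (Fin n) n) → Decidable (PlainMax π)
plainMax? π i = isLRMax? π i ×-dec ¬? (descentMax? π i)

perm-≤⇒< : (π : Vec (Fin n) n) → IsPerm π → ∀ {a b} → a ≢ b → lookup π a ≤ lookup π b → lookup π a < lookup π b
perm-≤⇒< π perm {a} {b} a≢b le = Fin.≤∧≢⇒< le (λ eq → a≢b (perm a b eq))

<⇒≢ : {a b : Fin n} → a < b → a ≢ b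
<⇒≢ lt refl = ℕ.<-irrefl refl lt

descentMax⇒isLRMax : (π : Vec (Fin n) n) → IsPerm π → ∀ {i} → DescentMax π i → IsLRMax π i
descentMax⇒isLRMax π perm (i′ , i<i′ , _ , top) h h<i =
  perm-≤⇒< π perm (<⇒≢ h<i) (top h (ℕ.<-trans h<i i<i′))

-- The entry right after `i` is the witness `i′` itself or precedes it; in the latter case `top`
-- bounds it by the value at `i`, strictly because values are distinct.
descentMax⇒initiatesDescent : ∀ {n} (π : Vec (Fin n) n) → IsPerm π → ∀ {i} → DescentMax π i → InitiatesDescent π i
descentMax⇒initiatesDescent {n} π perm {i} (i′ , i<i′ , lt , top) = s , s≡ , below (s Fin.≟ i′)
  where
  s<n : suc (toℕ i) ℕ.< n
  s<n = ℕ.≤-<-trans i<i′ (Fin.toℕ<n i′)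
  s = fromℕ< s<n
  s≡ : toℕ s ≡ suc (toℕ i)
  s≡ = Fin.toℕ-fromℕ< s<n
  i<s : i < s
  i<s = ℕ.≤-reflexive (sym s≡)
  below : Dec (s ≡ i′) → lookup π s < lookup π i
  below (yes eq) = subst (λ x → lookup π x < lookup π i) (sym eq) lt
  below (no s≢i′) = perm-≤⇒< π perm (λ eq → <⇒≢ i<s (sym eq))
    (top s (Fin.≤∧≢⇒< (subst (ℕ._≤ toℕ i′) (sym s≡) i<i′) s≢i′))

initiatesDescent⇒descentMax : (π : Vec (Fin n) n) → ∀ {i} → IsLRMax π i → InitiatesDescent π i → DescentMax π i
initiatesDescent⇒descentMax π {i} lr (i′ , eq , lt) = i′ , ℕ.≤-reflexive (sym eq) , lt , top
  where
  top : ∀ h → h < i′ → lookup π h ≤ lookup π i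
  top h h<i′ with h Fin.≟ i
  ... | yes refl = ℕ.≤-refl
  ... | no h≢i = ℕ.<⇒≤ (lr h (Fin.≤∧≢⇒< (ℕ.≤-pred (subst (toℕ h ℕ.<_) eq h<i′)) h≢i))

-- Avoidance phrased through descent-initiating maxima alone, so that it survives inserting or
-- deleting a plain maximum.
Separated : Vec (Fin n) n → Set
Separated π = ∀ a b c → a < b → b < c → lookup π b < lookup π a → lookup π c < lookup π b →
  ∃ λ i → DescentMax π i × lookup π c < lookup π i × lookup π i < lookup π b

-- The separating maximum is the largest entry preceding the smallest entry of the pattern 31542.
avoids⇒separated : (π : Vec (Fin n) n) → IsPerm π → Avoids31542 π → Separated π
avoids⇒separated π perm av a b c a<b b<c b<a c<b
  -- Replacing `a` by the first entry above the middle one ensures that everything preceding it, in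
  -- particular the maximum found below, is at most the middle value.
  with extremal (λ x → lookup π b <? lookup π x) Fin.≤-total ℕ.≤-trans (a , b<a)
... | a₀ , b<a₀ , first
  with av a₀ b c (ℕ.≤-<-trans (first a b<a) a<b) b<c b<a₀ c<b
... | d , e , d<e , e<a₀ , e<c , c<d , d<b
  with extremal (_<? e) {λ x y → lookup π y ≤ lookup π x} (λ x y → Fin.≤-total (lookup π y) (lookup π x))
         (λ p q → ℕ.≤-trans q p) (d , d<e)
... | i , i<e , top = i , (e , i<e , ℕ.<-trans e<c c<i , top) , c<i ,
  perm-≤⇒< π perm i≢b (ℕ.≮⇒≥ (λ b<i → ℕ.<⇒≱ (ℕ.<-trans i<e e<a₀) (first i b<i)))
  where
  c<i : lookup π c < lookup π i
  c<i = ℕ.<-≤-trans c<d (top d d<e)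
  i≢b : i ≢ b
  i≢b refl = ℕ.<⇒≱ (ℕ.<-trans i<e e<a₀) (ℕ.≤-trans (first a b<a) (ℕ.<⇒≤ a<b))

-- Let `i` be a separating maximum with descent witness `i′`. If the value at `i′` is below that at
-- `c`, then `i` and `i′` are the required `d` and `e`. Otherwise `i`, `i′`, `c` form a decreasing
-- triple with a smaller middle value, and induction on that value applies.
separated⇒avoids : (π : Vec (Fin n) n) → IsPerm π → Separated π → Avoids31542 π
separated⇒avoids π perm sep a b c a<b b<c b<a c<b = go a b c (<-wellFounded _) a<b b<c b<a c<b
  where
  go : ∀ a b c → Acc ℕ._<_ (toℕ (lookup π b)) → a < b → b < c →
    lookup π b < lookup π a → lookup π c < lookup π b →
    ∃ λ d → ∃ λ e → d < e × e < a × lookup π e < lookup π c × lookup π c < lookup π d × lookup π d < lookup π b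
  go a b c (acc rs) a<b b<c b<a c<b with sep a b c a<b b<c b<a c<b
  ... | i , (i′ , i<i′ , i′<i , top) , c<i , i<b = case (Fin.<-cmp (lookup π i′) (lookup π c))
    where
    i′<a : i′ < a
    -- If `a` preceded `i′`, then `top` would bound its value by that at `i`, which is below those
    -- at `b` and `a`.
    i′<a = Fin.≤∧≢⇒< (ℕ.≮⇒≥ (λ a<i′ → ℕ.<⇒≱ (ℕ.<-trans i<b b<a) (top a a<i′)))
      λ { refl → ℕ.<-asym i′<i (ℕ.<-trans i<b b<a) }
    case : Tri (lookup π i′ < lookup π c) (lookup π i′ ≡ lookup π c) (lookup π c < lookup π i′) → _
    case (tri< lt _ _) = i , i′ , i<i′ , i′<a , lt , c<i , i<b
    case (tri≈ _ eq _) = ⊥-elim (ℕ.<-asym (ℕ.<-trans a<b b<c) (subst (_< a) (perm i′ c eq) i′<a))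
    case (tri> _ _ gt) with go i i′ c (rs (ℕ.<-trans i′<i i<b)) i<i′ (ℕ.<-trans i′<a (ℕ.<-trans a<b b<c)) i′<i gt
    ... | d , e , d<e , e<i , e<c , c<d , d<i′ =
      d , e , d<e , ℕ.<-trans e<i (ℕ.<-trans i<i′ i′<a) , e<c , c<d , ℕ.<-trans d<i′ (ℕ.<-trans i′<i i<b)

-- Inserting and deleting an entry

punchIn-mono-< : ∀ p {i h : Fin n} → i < h → punchIn p i < punchIn p h
punchIn-mono-< p i<h = ℕ.≰⇒> (λ le → ℕ.<⇒≱ i<h (punchIn-cancel-≤ p _ _ le))

punchIn-cancel-< : ∀ p {i h : Fin n} → punchIn p i < punchIn p h → i < h
punchIn-cancel-< p lt = ℕ.≰⇒> (λ le → ℕ.<⇒≱ lt (punchIn-mono-≤ p _ _ le))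

data PunchView (p : Fin (suc n)) : Fin (suc n) → Set where
  hole  : PunchView p p
  other : ∀ i → PunchView p (punchIn p i)

punchView : (p x : Fin (suc n)) → PunchView p x
punchView p x with p Fin.≟ x
... | yes refl = hole
... | no p≢x = subst (PunchView p) (punchIn-punchOut p≢x) (other _)

size-positions : {P : Fin n → Set} (P? : Decidable P) → Size P (length (filter P? (allFin n)))
size-positions {n} P? = size-filter P? (Uniq.allFin⁺ n) ∈-allFin

module _ {n} (p : Fin (suc n)) {P : Fin (suc n) → Set} {Q : Fin n → Set}
  (to : ∀ {h} → Q h → P (punchIn p h)) (from : ∀ {h} → P (punchIn p h) → Q h) where

  size-others : Size Q m → Size (λ x → P x × x ≢ p) m
  size-others s = size-relate (λ h x → punchIn p h ≡ x) s
    (λ q → _ , (to q , punchInᵢ≢i p _) , refl)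
    (λ {x} (px , x≢p) → back (punchView p x) px x≢p)
    (λ _ _ _ eq eq′ → trans (sym eq) eq′)
    (λ _ _ _ eq eq′ → punchIn-injective p _ _ (trans eq (sym eq′)))
    where
    back : ∀ {x} → PunchView p x → P x → x ≢ p → ∃ λ h → Q h × punchIn p h ≡ x
    back hole _ x≢p = ⊥-elim (x≢p refl)
    back (other i) px _ = i , from px , refl

  size-punchIn-∉ : ¬ P p → Size Q m → Size P m
  size-punchIn-∉ ¬p s = size-cong proj₁ (λ px → px , λ { refl → ¬p px }) (size-others s)

  size-punchIn-∈ : P p → Size Q m → Size P (suc m)
  size-punchIn-∈ pp s = size-cong
    [ (λ { refl → pp }) , proj₁ ]
    (λ {x} px → split px (x Fin.≟ p))
    (size-⊎ (size-singleton {P = _≡ p} refl sym) (size-others s) (λ { refl (_ , x≢p) → x≢p refl }))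
    where
    split : ∀ {x} → P x → Dec (x ≡ p) → x ≡ p ⊎ (P x × x ≢ p)
    split _ (yes eq) = inj₁ eq
    split px (no x≢p) = inj₂ (px , x≢p)

  -- Being decidable, `Q` has some size; carrying it over to `P` and comparing with the given size
  -- of `P` identifies it.
  size-punchOut-∉ : Decidable Q → ¬ P p → Size P m → Size Q m
  size-punchOut-∉ Q? ¬p s =
    subst (Size Q) (size-unique (size-punchIn-∉ ¬p (size-positions Q?)) s) (size-positions Q?)

  size-punchOut-∈ : Decidable Q → P p → Size P (suc m) → Size Q m
  size-punchOut-∈ Q? pp s =
    subst (Size Q) (ℕ.suc-injective (size-unique (size-punchIn-∈ pp (size-positions Q?)) s)) (size-positions Q?)

-- `σ` is the standardized pattern left when position `p` is deleted from `π`: `punchIn` raises by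
-- one exactly the values of `σ` not below the value at `p`.
Extends : Vec (Fin (suc n)) (suc n) → Fin (suc n) → Vec (Fin n) n → Set
Extends π p σ = ∀ i → lookup π (punchIn p i) ≡ punchIn (lookup π p) (lookup σ i)

extension : (v p : Fin (suc n)) (σ : Vec (Fin n) n) → ∃ λ π → Extends π p σ × lookup π p ≡ v
extension v p σ = π , ext , π-p
  where
  π = insertAt (Vec.map (punchIn v) σ) p v
  π-p = insertAt-lookup (Vec.map (punchIn v) σ) p v
  ext : Extends π p σ
  ext i = trans (insertAt-punchIn _ p v i) (trans (lookup-map i (punchIn v) σ)
    (cong (λ x → punchIn x (lookup σ i)) (sym π-p)))

restriction : (π : Vec (Fin (suc n)) (suc n)) → IsPerm π → ∀ p → ∃ λ σ → Extends π p σ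
restriction π perm p = tabulate entry , λ i →
  trans (sym (punchIn-punchOut (ne i))) (cong (punchIn _) (sym (lookup∘tabulate entry i)))
  where
  ne : ∀ i → lookup π p ≢ lookup π (punchIn p i)
  ne i eq = punchInᵢ≢i p i (sym (perm _ _ eq))
  entry = λ i → punchOut (ne i)

restriction-unique : (π : Vec (Fin (suc n)) (suc n)) (p : Fin (suc n)) (σ τ : Vec (Fin n) n) →
  Extends π p σ → Extends π p τ → σ ≡ τ
restriction-unique π p σ τ e e′ = lookup-ext σ τ (λ i → punchIn-injective (lookup π p) _ _ (trans (sym (e i)) (e′ i)))

extension-unique : (π ρ : Vec (Fin (suc n)) (suc n)) (p : Fin (suc n)) (σ : Vec (Fin n) n) →
  Extends π p σ → Extends ρ p σ → lookup π p ≡ lookup ρ p → π ≡ ρ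
extension-unique π ρ p σ e e′ eq = lookup-ext π ρ (λ x → same (punchView p x))
  where
  same : ∀ {x} → PunchView p x → lookup π x ≡ lookup ρ x
  same hole = eq
  same (other i) = trans (e i) (trans (cong (λ v → punchIn v (lookup σ i)) eq) (sym (e′ i)))

module Extension {n} (π : Vec (Fin (suc n)) (suc n)) (p : Fin (suc n)) (σ : Vec (Fin n) n)
  (ext : Extends π p σ) where

  value-< : ∀ {i h} → lookup σ i < lookup σ h → lookup π (punchIn p i) < lookup π (punchIn p h)
  value-< {i} {h} lt = subst₂ _<_ (sym (ext i)) (sym (ext h)) (punchIn-mono-< (lookup π p) lt)

  value-<⁻ : ∀ {i h} → lookup π (punchIn p i) < lookup π (punchIn p h) → lookup σ i < lookup σ h
  value-<⁻ {i} {h} lt = punchIn-cancel-< (lookup π p) (subst₂ _<_ (ext i) (ext h) lt)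

  value-≤ : ∀ {i h} → lookup σ i ≤ lookup σ h → lookup π (punchIn p i) ≤ lookup π (punchIn p h)
  value-≤ le = ℕ.≮⇒≥ (λ lt → ℕ.<⇒≱ (value-<⁻ lt) le)

  value-≤⁻ : ∀ {i h} → lookup π (punchIn p i) ≤ lookup π (punchIn p h) → lookup σ i ≤ lookup σ h
  value-≤⁻ le = ℕ.≮⇒≥ (λ lt → ℕ.<⇒≱ (value-< lt) le)

  restriction-perm : IsPerm π → IsPerm σ
  restriction-perm perm a b eq = punchIn-injective p a b (perm _ _
    (trans (ext a) (trans (cong (punchIn (lookup π p)) eq) (sym (ext b)))))

  extension-perm : IsPerm σ → IsPerm π
  extension-perm perm a b = go (punchView p a) (punchView p b)
    where
    go : ∀ {a b} → PunchView p a → PunchView p b → lookup π a ≡ lookup π b → a ≡ b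
    go hole hole _ = refl
    go hole (other i) eq = ⊥-elim (punchInᵢ≢i (lookup π p) _ (sym (trans eq (ext i))))
    go (other i) hole eq = ⊥-elim (punchInᵢ≢i (lookup π p) _ (trans (sym (ext i)) eq))
    go (other i) (other h) eq = cong (punchIn p) (perm i h (punchIn-injective (lookup π p) _ _
      (trans (sym (ext i)) (trans eq (ext h)))))

  restriction-isLRMax : ∀ {i} → IsLRMax π (punchIn p i) → IsLRMax σ i
  restriction-isLRMax lr h h<i = value-<⁻ (lr (punchIn p h) (punchIn-mono-< p h<i))

  extension-isLRMax : ∀ {i} → (p < punchIn p i → lookup π p < lookup π (punchIn p i)) →
    IsLRMax σ i → IsLRMax π (punchIn p i)
  extension-isLRMax {i} above lr x = go (punchView p x)
    where
    go : ∀ {x} → PunchView p x → x < punchIn p i → lookup π x < lookup π (punchIn p i)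
    go hole = above
    go (other h) lt = value-< (lr h (punchIn-cancel-< p lt))

  restriction-descentMax : ∀ {i} → (d : DescentMax π (punchIn p i)) → proj₁ d ≢ p → DescentMax σ i
  restriction-descentMax {i} (x , i<x , x<i , top) = go (punchView p x) i<x x<i top
    where
    go : ∀ {x} → PunchView p x → punchIn p i < x → lookup π x < lookup π (punchIn p i) →
      (∀ h → h < x → lookup π h ≤ lookup π (punchIn p i)) → x ≢ p → DescentMax σ i
    go hole _ _ _ x≢p = ⊥-elim (x≢p refl)
    go (other i′) lt below top _ = i′ , punchIn-cancel-< p lt , value-<⁻ below ,
      λ h h<i′ → value-≤⁻ (top (punchIn p h) (punchIn-mono-< p h<i′))

  -- The new entry can only violate the bound on the entries in front of the witness, hence the
  -- proviso.
  extension-descentMax : ∀ {i} (d : DescentMax σ i) →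
    (p < punchIn p (proj₁ d) → lookup π p ≤ lookup π (punchIn p i)) → DescentMax π (punchIn p i)
  extension-descentMax {i} (i′ , i<i′ , i′<i , top) above =
    punchIn p i′ , punchIn-mono-< p i<i′ , value-< i′<i , λ x → go (punchView p x)
    where
    go : ∀ {x} → PunchView p x → x < punchIn p i′ → lookup π x ≤ lookup π (punchIn p i)
    go hole = above
    go (other h) lt = value-≤ (top h (punchIn-cancel-< p lt))

-- Inserting and deleting a plain maximum

Structured : ℕ → ℕ → Vec (Fin n) n → Set
Structured j k π = IsPerm π × Separated π × Size (DescentMax π) j × Size (PlainMax π) k

module PlainExtension {n} (π : Vec (Fin (suc n)) (suc n)) (p : Fin (suc n)) (σ : Vec (Fin n) n)
  (ext : Extends π p σ) (plain : PlainMax π p) where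

  open Extension π p σ ext

  private
    lr = proj₁ plain
    ¬desc = proj₂ plain

  -- Suppose a maximum of `σ` placed after `p` were below the new entry. Then so would be everything
  -- of `σ` in front of it, and `p` would initiate a descent witnessed by it.
  plain-isLRMax : ∀ {i} → IsLRMax σ i → IsLRMax π (punchIn p i)
  plain-isLRMax {i} lrσ = extension-isLRMax above lrσ
    where
    above : p < punchIn p i → lookup π p < lookup π (punchIn p i)
    above p<i = ℕ.≰⇒> λ le → ¬desc (punchIn p i , p<i , Fin.≤∧≢⇒< le
      (λ eq → punchInᵢ≢i (lookup π p) _ (trans (sym (ext i)) eq)) , λ x → go le (punchView p x))
      where
      go : lookup π (punchIn p i) ≤ lookup π p → ∀ {x} → PunchView p x → x < punchIn p i → lookup π x ≤ lookup π p
      go le hole _ = ℕ.≤-refl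
      go le (other h) lt = ℕ.≤-trans (value-≤ (ℕ.<⇒≤ (lrσ h (punchIn-cancel-< p lt)))) le

  -- If the new entry came before the witness `i′` and exceeded the entry at `i`, it would exceed
  -- all the others in front of `i′` as well, so `i′` would witness a descent of `p`.
  plain-descentMax : ∀ {i} → DescentMax σ i → DescentMax π (punchIn p i)
  plain-descentMax {i} d@(i′ , i<i′ , i′<i , top) = extension-descentMax d above
    where
    above : p < punchIn p i′ → lookup π p ≤ lookup π (punchIn p i)
    above p<i′ = ℕ.≮⇒≥ λ lt → ¬desc (punchIn p i′ , p<i′ , ℕ.<-trans (value-< i′<i) lt , λ x → go lt (punchView p x))
      where
      go : lookup π (punchIn p i) < lookup π p → ∀ {x} → PunchView p x → x < punchIn p i′ → lookup π x ≤ lookup π p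
      go lt hole _ = ℕ.≤-refl
      go lt (other h) h<i′ = ℕ.≤-trans (value-≤ (top h (punchIn-cancel-< p h<i′))) (ℕ.<⇒≤ lt)

  plain-descentMax⁻ : ∀ {i} → DescentMax π (punchIn p i) → DescentMax σ i
  -- The witness is not `p`: as a left-to-right maximum after `i`, the entry at `p` is the larger
  -- one.
  plain-descentMax⁻ d@(x , i<x , x<i , _) = restriction-descentMax d λ { refl → ℕ.<-asym x<i (lr _ i<x) }

  plain-plainMax : ∀ {i} → PlainMax σ i → PlainMax π (punchIn p i)
  plain-plainMax (l , ¬d) = plain-isLRMax l , ¬d ∘ plain-descentMax⁻

  plain-plainMax⁻ : ∀ {i} → PlainMax π (punchIn p i) → PlainMax σ i
  plain-plainMax⁻ (l , ¬d) = restriction-isLRMax l , ¬d ∘ plain-descentMax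

  plain-separated⁻ : Separated π → Separated σ
  plain-separated⁻ sep a b c a<b b<c b<a c<b
    with sep (punchIn p a) (punchIn p b) (punchIn p c) (punchIn-mono-< p a<b) (punchIn-mono-< p b<c) (value-< b<a) (value-< c<b)
  ... | x , d , c<x , x<b with punchView p x
  ... | hole = ⊥-elim (¬desc d)
  ... | other i = i , plain-descentMax⁻ d , value-<⁻ c<x , value-<⁻ x<b

  -- When the inserted maximum plays the largest entry of the triple, some larger entry precedes
  -- the middle one, since otherwise p would initiate a descent; so that entry can take over.
  plain-separated : Separated σ → Separated π
  plain-separated sep a b c a<b = go (punchView p a) (punchView p b) (punchView p c) a<b
    where
    go : ∀ {a b c} → PunchView p a → PunchView p b → PunchView p c → a < b → b < c →
      lookup π b < lookup π a → lookup π c < lookup π b →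
      ∃ λ i → DescentMax π i × lookup π c < lookup π i × lookup π i < lookup π b
    go {a} _ hole _ a<b _ b<a _ = ⊥-elim (ℕ.<-asym b<a (lr a a<b))
    go {b = b} _ _ hole _ b<c _ c<b = ⊥-elim (ℕ.<-asym c<b (lr b b<c))
    go (other a) (other b) (other c) a<b b<c b<a c<b
      with sep a b c (punchIn-cancel-< p a<b) (punchIn-cancel-< p b<c) (value-<⁻ b<a) (value-<⁻ c<b)
    ... | i , d , c<i , i<b = punchIn p i , plain-descentMax d , value-< c<i , value-< i<b
    go hole (other b) (other c) a<b b<c b<a c<b
      with any? (λ x → (x <? punchIn p b) ×-dec (lookup π p <? lookup π x))
    ... | no ¬e = ⊥-elim (¬desc (punchIn p b , a<b , b<a , λ x x<b → ℕ.≮⇒≥ (λ lt → ¬e (x , x<b , lt))))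
    ... | yes (x , x<b , p<x) with punchView p x
    ... | hole = ⊥-elim (ℕ.<-irrefl refl p<x)
    ... | other i = go (other i) (other b) (other c) x<b b<c (ℕ.<-trans b<a p<x) c<b

  plain-structured : Structured j k σ → Structured j (suc k) π
  plain-structured (perm , sep , ds , ps) = extension-perm perm , plain-separated sep ,
    size-punchIn-∉ p plain-descentMax plain-descentMax⁻ ¬desc ds ,
    size-punchIn-∈ p plain-plainMax plain-plainMax⁻ plain ps

  plain-structured⁻ : Structured j (suc k) π → Structured j k σ
  plain-structured⁻ (perm , sep , ds , ps) = restriction-perm perm , plain-separated⁻ sep ,
    size-punchOut-∉ p plain-descentMax plain-descentMax⁻ (descentMax? σ) ¬desc ds ,
    size-punchOut-∈ p plain-plainMax plain-plainMax⁻ (plainMax? σ) plain ps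

-- From the filtered list of words to structured permutations

unique-concatMap : {A B : Set} (f : A → List B) → ∀ {xs} → Unique xs → (∀ x → Unique (f x)) →
  (∀ {x y b} → b ∈ f x → b ∈ f y → x ≡ y) → Unique (concatMap f xs)
unique-concatMap f [] _ _ = []
unique-concatMap f {x ∷ xs} (x∉ ∷ u) uf inj = Uniq.++⁺ (uf x) (unique-concatMap f u uf inj) λ (b∈ , b∈′) →
  let (y , y∈ , b∈y) = find (∈-concatMap⁻ f {xs = xs} b∈′) in All.lookup x∉ y∈ (inj b∈ b∈y)

allWords-unique : ∀ m n → Unique (allWords m n)
allWords-unique zero n = All.[] ∷ []
allWords-unique (suc m) n = unique-concatMap _ (allWords-unique m n)
  (λ w → Uniq.map⁺ (λ { refl → refl }) (Uniq.allFin⁺ n)) same-tail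
  where
  same-tail : ∀ {w w′ : Vec (Fin n) m} {b} →
    b ∈ map (λ x → x Vec.∷ w) (allFin n) → b ∈ map (λ x → x Vec.∷ w′) (allFin n) → w ≡ w′
  same-tail b∈ b∈′ with ∈-map⁻ _ b∈ | ∈-map⁻ _ b∈′
  ... | _ , _ , refl | _ , _ , refl = refl

∈-allWords : ∀ {m n} (w : Vec (Fin n) m) → w ∈ allWords m n
∈-allWords [] = here refl
∈-allWords {suc m} {n} (x ∷ w) =
  ∈-concatMap⁺ (λ w → map (λ x → x Vec.∷ w) (allFin n)) {xs = allWords m n}
    (lose (∈-allWords w) (∈-map⁺ (λ x → x Vec.∷ w) (∈-allFin x)))

size-isLRMax : (π : Vec (Fin n) n) → IsPerm π → Size (DescentMax π) j → Size (PlainMax π) k → Size (IsLRMax π) (j + k)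
size-isLRMax π perm ds ps = size-cong
  [ descentMax⇒isLRMax π perm , proj₁ ]
  (λ {i} lr → split lr (descentMax? π i))
  (size-⊎ ds ps (λ d (_ , ¬d) → ¬d d))
  where
  split : ∀ {i} → IsLRMax π i → Dec (DescentMax π i) → DescentMax π i ⊎ PlainMax π i
  split _ (yes d) = inj₁ d
  split lr (no ¬d) = inj₂ (lr , ¬d)

module _ {n} (π : Vec (Fin n) n) (perm : IsPerm π) where

  size-lrmaxDesc : Size (DescentMax π) (lrmaxDesc π)
  size-lrmaxDesc = size-cong
    (λ (lr , d) → initiatesDescent⇒descentMax π lr d)
    (λ d → descentMax⇒isLRMax π perm d , descentMax⇒initiatesDescent π perm d)
    (size-positions (λ i → isLRMax? π i ×-dec initiatesDescent? π i))

  size-lrmaxNonDesc : Size (PlainMax π) (lrmaxNonDesc π)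
  size-lrmaxNonDesc = size-cong
    (λ (lr , ¬d) → lr , ¬d ∘ descentMax⇒initiatesDescent π perm)
    (λ (lr , ¬d) → lr , ¬d ∘ initiatesDescent⇒descentMax π lr)
    (size-positions (λ i → isLRMax? π i ×-dec ¬? (initiatesDescent? π i)))

counted⇒structured : (π : Vec (Fin n) n) → Counted n j k π → Structured j k π
counted⇒structured π (perm , av , _ , refl , refl) =
  perm , avoids⇒separated π perm av , size-lrmaxDesc π perm , size-lrmaxNonDesc π perm

structured⇒counted : (π : Vec (Fin n) n) → Structured j k π → Counted n j k π
structured⇒counted π (perm , sep , ds , ps) =
  perm , separated⇒avoids π perm sep ,
  size-unique (size-positions (isLRMax? π)) (size-isLRMax π perm ds ps) ,
  size-unique (size-lrmaxDesc π perm) ds , size-unique (size-lrmaxNonDesc π perm) ps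

size-structured : ∀ n j k → Size (Structured {n} j k) (countPerms n j k)
size-structured n j k = size-cong
  (λ {π} → counted⇒structured π) (λ {π} → structured⇒counted π)
  (size-filter (counted? n j k) (allWords-unique n n) ∈-allWords)

-- The place of a plain maximum with a given value

punchIn-below : (p : Fin (suc n)) (h : Fin n) → toℕ h ℕ.< toℕ p → toℕ (punchIn p h) ≡ toℕ h
punchIn-below (suc p) zero _ = refl
punchIn-below (suc p) (suc h) lt = cong suc (punchIn-below p h (ℕ.≤-pred lt))

punchIn-above : (p : Fin (suc n)) (h : Fin n) → toℕ p ℕ.≤ toℕ h → toℕ (punchIn p h) ≡ suc (toℕ h)
punchIn-above zero h _ = refl
punchIn-above (suc p) (suc h) le = cong suc (punchIn-above p h (ℕ.≤-pred le))

≤⇒<punchIn : (p : Fin (suc n)) (h : Fin n) → toℕ p ℕ.≤ toℕ h → p < punchIn p h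
≤⇒<punchIn p h le = subst (toℕ p ℕ.<_) (sym (punchIn-above p h le)) (ℕ.s≤s le)

<⇒punchIn< : (p : Fin (suc n)) (h : Fin n) → toℕ h ℕ.< toℕ p → punchIn p h < p
<⇒punchIn< p h lt = subst (ℕ._< toℕ p) (sym (punchIn-below p h lt)) lt

punchIn<⇒< : (p : Fin (suc n)) (h : Fin n) → punchIn p h < p → toℕ h ℕ.< toℕ p
punchIn<⇒< p h lt = ℕ.≰⇒> (λ le → ℕ.<-asym lt (≤⇒<punchIn p h le))

<punchIn⇒≤ : (p : Fin (suc n)) (h : Fin n) → p < punchIn p h → toℕ p ℕ.≤ toℕ h
<punchIn⇒≤ p h lt = ℕ.≮⇒≥ (λ h<p → ℕ.<-asym lt (<⇒punchIn< p h h<p))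

last-max : (i : Fin (suc n)) → ¬ (fromℕ n < i)
last-max i lt = ℕ.<⇒≱ lt (Fin.≤fromℕ i)

≢last⇒< : {i : Fin (suc n)} → i ≢ fromℕ n → i < fromℕ n
≢last⇒< ne = Fin.≤∧≢⇒< (Fin.≤fromℕ _) ne

last-plain : (π : Vec (Fin (suc n)) (suc n)) → IsLRMax π (fromℕ n) → PlainMax π (fromℕ n)
last-plain π lr = lr , λ (i , lt , _) → last-max i lt

-- The place is in front of the first entry exceeding `v`, or the end if there is none. Any later
-- entry below `v` has that larger entry in front of it, so it cannot witness a descent.
plain-position : (v : Fin (suc n)) (σ : Vec (Fin n) n) →
  ∃ λ p → ∀ {π} → Extends π p σ → lookup π p ≡ v → PlainMax π p
plain-position {n} v σ with any? (λ i → ¬? (punchIn v (lookup σ i) <? v))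
... | no ¬e = fromℕ n , λ {π} ext eq → last-plain π λ x → go π ext eq (punchView (fromℕ n) x)
  where
  go : ∀ π → Extends π (fromℕ n) σ → lookup π (fromℕ n) ≡ v → ∀ {x} → PunchView (fromℕ n) x → x < fromℕ n → lookup π x < lookup π (fromℕ n)
  go π ext refl hole lt = ⊥-elim (ℕ.<-irrefl refl lt)
  go π ext refl (other i) lt = subst (_< lookup π (fromℕ n)) (sym (ext i))
    (decidable-stable (_ <? _) (λ ¬lt → ¬e (i , ¬lt)))
... | yes e with extremal (λ i → ¬? (punchIn v (lookup σ i) <? v)) Fin.≤-total ℕ.≤-trans e
... | i₀ , big , first = p , λ {π} ext eq →
    (λ x → before π ext eq (punchView p x)) ,
    (λ (x , p<x , x<p , top) → after π ext eq (punchView p x) p<x x<p top)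
  where
  -- Inserting at the position of `i₀` itself pushes that entry one place to the right.
  p = inject₁ i₀
  p≡ : toℕ p ≡ toℕ i₀
  p≡ = Fin.toℕ-inject₁ i₀
  before : ∀ π → Extends π p σ → lookup π p ≡ v → ∀ {x} → PunchView p x → x < p → lookup π x < lookup π p
  before π ext refl hole lt = ⊥-elim (ℕ.<-irrefl refl lt)
  before π ext refl (other i) lt = subst (_< lookup π p) (sym (ext i)) (decidable-stable (_ <? _)
    (λ ¬lt → ℕ.<⇒≱ (subst (toℕ i ℕ.<_) p≡ (punchIn<⇒< p i lt)) (first i ¬lt)))
  after : ∀ π → Extends π p σ → lookup π p ≡ v → ∀ {x} → PunchView p x → p < x → lookup π x < lookup π p →
    (∀ h → h < x → lookup π h ≤ lookup π p) → ⊥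
  after π ext refl hole lt _ _ = ℕ.<-irrefl refl lt
  after π ext refl (other h) lt below top with i₀ Fin.≟ h
  ... | yes refl = big (subst (_< lookup π p) (ext h) below)
  ... | no i₀≢h = big (Fin.≤∧≢⇒< (subst (_≤ lookup π p) (ext i₀)
    (top _ (punchIn-mono-< p (Fin.≤∧≢⇒< (subst (ℕ._≤ toℕ h) p≡ (<punchIn⇒≤ p h lt)) i₀≢h)))) (punchInᵢ≢i _ _))

-- The entry of σ sitting at position i in ρ would follow the new entry in π and be smaller.
plain-position-≮ : (π ρ : Vec (Fin (suc n)) (suc n)) {i h : Fin (suc n)} (σ : Vec (Fin n) n) →
  Extends π i σ → Extends ρ h σ → lookup π i ≡ lookup ρ h → PlainMax π i → PlainMax ρ h → ¬ (i < h)
plain-position-≮ π ρ {i} {h} σ ext ext′ eq (_ , ¬d) (lr , _) i<h =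
  ¬d (punchIn i g , ≤⇒<punchIn i g (ℕ.≤-reflexive (sym g≡i)) , small g (subst (_< h) (sym at-g) i<h) ,
    λ x → top (punchView i x))
  where
  h≢i : h ≢ i
  h≢i refl = ℕ.<-irrefl refl i<h
  g = punchOut h≢i
  at-g : punchIn h g ≡ i
  at-g = punchIn-punchOut h≢i
  g≡i : toℕ g ≡ toℕ i
  g≡i = trans (sym (punchIn-below h g (punchIn<⇒< h g (subst (_< h) (sym at-g) i<h)))) (cong toℕ at-g)
  small : ∀ f → punchIn h f < h → lookup π (punchIn i f) < lookup π i
  small f lt = subst₂ _<_ (trans (ext′ f) (trans (cong (λ v → punchIn v (lookup σ f)) (sym eq)) (sym (ext f)))) (sym eq) (lr _ lt)
  top : ∀ {x} → PunchView i x → x < punchIn i g → lookup π x ≤ lookup π i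
  top hole _ = ℕ.≤-refl
  top (other f) lt = ℕ.<⇒≤ (small f (ℕ.<-trans (punchIn-mono-< h (punchIn-cancel-< i lt)) (subst (_< h) (sym at-g) i<h)))

-- Both sides count the permutations with a marked plain maximum, which is determined by its value
-- and the pattern of the remaining entries.
plain-step : ∀ n j k → countPerms (suc n) j (suc k) * suc k ≡ suc n * countPerms n j k
plain-step n j k = size-unique
  (size-relate {Q = λ (v , σ) → ⊤ × Structured j k σ}
    (λ (π , i) (v , σ) → Extends π i σ × lookup π i ≡ v)
    (size-Σ (size-structured (suc n) j (suc k)) (λ (_ , _ , _ , ps) → ps))
    (λ {(π , i)} (s , plain) → let (σ , ext) = restriction π (proj₁ s) i in
      (lookup π i , σ) , (tt , PlainExtension.plain-structured⁻ π i σ ext plain s) , ext , refl)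
    (λ {(v , σ)} (_ , s) → let (p , plain) = plain-position v σ ; (π , ext , eq) = extension v p σ in
      (π , p) , (PlainExtension.plain-structured π p σ ext (plain {π} ext eq) s , plain {π} ext eq) , ext , eq)
    (λ { {π , i} {v , σ} {_ , τ} _ _ _ (ext , refl) (ext′ , refl) → cong (v ,_) (restriction-unique π i σ τ ext ext′) })
    (λ { {π , i} {ρ , h} {v , σ} (_ , plain) (_ , plain′) _ (ext , eq) (ext′ , eq′) →
      injective {π} {ρ} {i} {h} {σ} ext ext′ (trans eq (sym eq′)) plain plain′ }))
  (size-Σ (size-Fin (suc n)) (λ _ → size-structured n j k))
  where
  injective : ∀ {π ρ : Vec (Fin (suc n)) (suc n)} {i h σ} → Extends π i σ → Extends ρ h σ → lookup π i ≡ lookup ρ h →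
    PlainMax π i → PlainMax ρ h → (π , i) ≡ (ρ , h)
  injective {π} {ρ} {i} {h} {σ} ext ext′ eq plain plain′ with Fin.<-cmp i h
  ... | tri< lt _ _ = ⊥-elim (plain-position-≮ π ρ {i} {h} σ ext ext′ eq plain plain′ lt)
  ... | tri> _ _ gt = ⊥-elim (plain-position-≮ ρ π {h} {i} σ ext′ ext (sym eq) plain′ plain gt)
  ... | tri≈ _ refl _ = cong (_, i) (extension-unique π ρ i σ ext ext′ eq)

-- Appending and removing a last entry

last-above : (i : Fin n) → ¬ (fromℕ n < punchIn (fromℕ n) i)
last-above i = last-max _

below-last : (i : Fin n) → punchIn (fromℕ n) i < fromℕ n
below-last i = ≢last⇒< (punchInᵢ≢i _ i)

-- The permutations which, once a smaller entry is appended, have no plain maximum left.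
Appendable : ∀ {n} → ℕ → Vec (Fin n) n → Set
Appendable {n} j σ = IsPerm σ × Separated σ × Size (IsLRMax σ) j × (∀ i → PlainMax σ i → (h : Fin n) → ¬ (i < h))

module LastExtension {n} (π : Vec (Fin (suc n)) (suc n)) (σ : Vec (Fin n) n)
  (ext : Extends π (fromℕ n) σ) where

  open Extension π (fromℕ n) σ ext

  last-isLRMax : ∀ {i} → IsLRMax σ i → IsLRMax π (punchIn (fromℕ n) i)
  last-isLRMax {i} = extension-isLRMax λ lt → ⊥-elim (last-above i lt)

  last-descentMax : ∀ {i} → DescentMax σ i → DescentMax π (punchIn (fromℕ n) i)
  last-descentMax d = extension-descentMax d λ lt → ⊥-elim (last-above (proj₁ d) lt)

  -- Giving the last entry the old value at `i` raises the entry at `i` by one, so the last entry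
  -- becomes its immediate predecessor in value.
  module Append {i} (lrᵢ : IsLRMax σ i) (v≡ : lookup π (fromℕ n) ≡ inject₁ (lookup σ i)) where

    toℕ-v : toℕ (lookup π (fromℕ n)) ≡ toℕ (lookup σ i)
    toℕ-v = trans (cong toℕ v≡) (Fin.toℕ-inject₁ _)

    above-v : ∀ {h} → lookup σ i ≤ lookup σ h → lookup π (fromℕ n) < lookup π (punchIn (fromℕ n) h)
    above-v {h} le = subst (_ <_) (sym (ext h)) (≤⇒<punchIn _ _ (subst (ℕ._≤ toℕ (lookup σ h)) (sym toℕ-v) le))

    above-v⁻ : ∀ {h} → lookup π (fromℕ n) < lookup π (punchIn (fromℕ n) h) → lookup σ i ≤ lookup σ h
    above-v⁻ {h} lt = subst (ℕ._≤ toℕ (lookup σ h)) toℕ-v (<punchIn⇒≤ _ _ (subst (_ <_) (ext h) lt))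

    ¬last-isLRMax : ¬ IsLRMax π (fromℕ n)
    ¬last-isLRMax lr = ℕ.<-asym (lr _ (below-last i)) (above-v ℕ.≤-refl)

    -- A left-to-right maximum in last position is the largest entry of `σ`, hence at least the one
    -- at `i`, and so above the appended entry.
    last-max-descends : ∀ {h} → IsPerm σ → IsLRMax σ h → (∀ g → ¬ (h < g)) → DescentMax π (punchIn (fromℕ n) h)
    last-max-descends {h} perm lr last = fromℕ n , below-last h , above-v (top i) ,
      λ x → go (punchView (fromℕ n) x)
      where
      top : ∀ g → lookup σ g ≤ lookup σ h
      top g with g Fin.≟ h
      ... | yes refl = ℕ.≤-refl
      ... | no g≢h = ℕ.<⇒≤ (lr g (Fin.≤∧≢⇒< (ℕ.≮⇒≥ (last g)) g≢h))
      go : ∀ {x} → PunchView (fromℕ n) x → x < fromℕ n → lookup π x ≤ lookup π (punchIn (fromℕ n) h)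
      go hole lt = ⊥-elim (ℕ.<-irrefl refl lt)
      go (other g) _ = value-≤ (top g)

    module _ (app : Appendable j σ) where
      private
        permσ = proj₁ app
        sepσ = proj₁ (proj₂ app)

      all-descend : ∀ {h} → IsLRMax σ h → DescentMax π (punchIn (fromℕ n) h)
      all-descend {h} lr with descentMax? σ h
      ... | yes d = last-descentMax d
      ... | no ¬d = last-max-descends permσ lr (proj₂ (proj₂ (proj₂ app)) h (lr , ¬d))

      append-separated : Separated π
      append-separated a b c = go (punchView (fromℕ n) a) (punchView (fromℕ n) b) (punchView (fromℕ n) c)
        where
        go : ∀ {a b c} → PunchView (fromℕ n) a → PunchView (fromℕ n) b → PunchView (fromℕ n) c → a < b → b < c →
          lookup π b < lookup π a → lookup π c < lookup π b →
          ∃ λ x → DescentMax π x × lookup π c < lookup π x × lookup π x < lookup π b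
        go hole _ _ a<b _ _ _ = ⊥-elim (last-max _ a<b)
        go _ hole _ _ b<c _ _ = ⊥-elim (last-max _ b<c)
        go (other a) (other b) (other c) a<b b<c b<a c<b
          with sepσ a b c (punchIn-cancel-< _ a<b) (punchIn-cancel-< _ b<c) (value-<⁻ b<a) (value-<⁻ c<b)
        ... | x , d , c<x , x<b = punchIn _ x , last-descentMax d , value-< c<x , value-< x<b
        -- With the appended entry as the smallest of the triple, the maximum `i` separates: its
        -- value comes right after the appended one, and `b` differs from `i` because the larger
        -- entry at `a` precedes `b`.
        go (other a) (other b) hole a<b _ b<a c<b =
          punchIn _ i , all-descend lrᵢ , above-v ℕ.≤-refl ,
          value-< (perm-≤⇒< σ permσ (λ { refl → ℕ.<-asym (value-<⁻ b<a) (lrᵢ a (punchIn-cancel-< _ a<b)) }) (above-v⁻ c<b))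

      append-structured : Structured j 0 π
      append-structured = extension-perm permσ , append-separated ,
        size-punchIn-∉ (fromℕ n) {P = DescentMax π} {Q = IsLRMax σ} all-descend
          (λ d → restriction-isLRMax (descentMax⇒isLRMax π (extension-perm permσ) d))
          (λ (x , lt , _) → last-max x lt) (proj₁ (proj₂ (proj₂ app))) ,
        size-∅ λ {x} (lr , ¬d) → none (punchView (fromℕ n) x) lr ¬d
        where
        none : ∀ {x} → PunchView (fromℕ n) x → IsLRMax π x → ¬ DescentMax π x → ⊥
        none hole lr _ = ¬last-isLRMax lr
        none (other h) lr ¬d = ¬d (all-descend (restriction-isLRMax lr))

  module Unappend (s : Structured j 0 π) where
    private
      perm = proj₁ s
      sep = proj₁ (proj₂ s)
      ¬plain : ∀ {x} → ¬ PlainMax π x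
      ¬plain = size-0 (proj₂ (proj₂ (proj₂ s)))

    ¬last-isLRMax : ¬ IsLRMax π (fromℕ n)
    ¬last-isLRMax lr = ¬plain (last-plain π lr)

    -- Were the last value the largest, the last entry would be a plain maximum.
    not-top : n ≢ toℕ (lookup π (fromℕ n))
    not-top eq = ¬last-isLRMax λ x lt → perm-≤⇒< π perm (<⇒≢ lt)
      (subst (toℕ (lookup π x) ℕ.≤_) eq (ℕ.≤-pred (Fin.toℕ<n (lookup π x))))

    separated⁻ : Separated σ
    separated⁻ a b c a<b b<c b<a c<b
      with sep (punchIn _ a) (punchIn _ b) (punchIn _ c) (punchIn-mono-< _ a<b) (punchIn-mono-< _ b<c) (value-< b<a) (value-< c<b)
    ... | x , d@(_ , _ , _ , top) , c<x , x<b with punchView (fromℕ n) x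
    ... | hole = ⊥-elim (last-max _ (proj₁ (proj₂ d)))
    -- A descent witnessed by the last entry would make the separating maximum at least as large as
    -- the entry at `a`, although it lies below the one at `b`.
    ... | other i = i , restriction-descentMax d
      (λ { refl → ℕ.<⇒≱ (ℕ.<-trans x<b (value-< b<a)) (top _ (below-last a)) }) , value-<⁻ c<x , value-<⁻ x<b

    unappend-appendable : Appendable j σ
    unappend-appendable = restriction-perm perm , separated⁻ ,
      size-punchOut-∉ (fromℕ n) {P = DescentMax π} {Q = IsLRMax σ}
        descends (λ d → restriction-isLRMax (descentMax⇒isLRMax π perm d)) (isLRMax? σ)
        (λ (x , lt , _) → last-max x lt) (proj₁ (proj₂ (proj₂ s))) ,
      last-only
      where
      descends : ∀ {h} → IsLRMax σ h → DescentMax π (punchIn (fromℕ n) h)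
      descends lr = decidable-stable (descentMax? π _) (λ ¬d → ¬plain (last-isLRMax lr , ¬d))
      last-only : ∀ i → PlainMax σ i → ∀ h → ¬ (i < h)
      -- A maximum plain in `σ` descends in `π` only through the last entry, so it is the largest of
      -- `σ`; any entry `h` after it would then already witness a descent in `σ`.
      last-only i (lr , ¬d) h i<h with descends lr
      ... | d@(x , _ , _ , top) = ¬d (restriction-descentMax d λ { refl → ¬d (h , i<h ,
        perm-≤⇒< σ (restriction-perm perm) (λ eq → <⇒≢ i<h (sym eq)) (value-≤⁻ (top _ (below-last h))) ,
        λ g _ → value-≤⁻ (top _ (below-last g))) })

    -- By `not-top` some entry has the value just above the last one; `i` is its position.
    unappend-isLRMax : ∃ λ i → IsLRMax σ i × lookup π (fromℕ n) ≡ inject₁ (lookup σ i)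
    unappend-isLRMax with injective⇒surjective (lookup σ) (restriction-perm perm) (lower₁ _ not-top)
    ... | i , eq = i , lr , v≡
      where
      v≡ : lookup π (fromℕ n) ≡ inject₁ (lookup σ i)
      v≡ = sym (trans (cong inject₁ eq) (Fin.inject₁-lower₁ _ not-top))
      toℕ-v : toℕ (lookup π (fromℕ n)) ≡ toℕ (lookup σ i)
      toℕ-v = trans (cong toℕ v≡) (Fin.toℕ-inject₁ _)
      v<i : lookup π (fromℕ n) < lookup π (punchIn (fromℕ n) i)
      v<i = subst (_ <_) (sym (ext i)) (≤⇒<punchIn _ _ (ℕ.≤-reflexive toℕ-v))
      -- The values at i and at the end of π are consecutive, so nothing separates them.
      lr : IsLRMax σ i
      lr h h<i = ℕ.≰⇒> λ le → unseparated
        (sep (punchIn _ h) (punchIn _ i) (fromℕ n) (punchIn-mono-< _ h<i) (below-last i)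
          (value-< (perm-≤⇒< σ (restriction-perm perm) (λ eq → <⇒≢ h<i (sym eq)) le)) v<i)
        where
        unseparated : ¬ (∃ λ x → DescentMax π x × lookup π (fromℕ n) < lookup π x × lookup π x < lookup π (punchIn _ i))
        unseparated (x , _ , v<x , x<i) with punchView (fromℕ n) x
        ... | hole = ℕ.<-irrefl refl v<x
        ... | other y = ℕ.<⇒≱ (value-<⁻ x<i)
          (subst (ℕ._≤ toℕ (lookup σ y)) toℕ-v (<punchIn⇒≤ _ _ (subst (_ <_) (ext y) v<x)))

-- The permutations on `suc n` letters correspond to pairs of an appendable `σ` and one of its `j`
-- left-to-right maxima, chosen as the successor in value of the last entry.
append-step : ∀ n j {r} → Size (Appendable {n} j) r → countPerms (suc n) j 0 ≡ r * j
append-step n j size = size-unique (size-structured (suc n) j 0)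
  (size-relate {P = λ (σ , i) → Appendable j σ × IsLRMax σ i}
    (λ (σ , i) π → Extends π (fromℕ n) σ × lookup π (fromℕ n) ≡ inject₁ (lookup σ i))
    (size-Σ size (λ (_ , _ , s , _) → s))
    (λ {(σ , i)} (app , lr) → let (π , ext , v≡) = extension (inject₁ (lookup σ i)) (fromℕ n) σ in
      π , LastExtension.Append.append-structured π σ ext lr v≡ app , ext , v≡)
    (λ {π} s → let (σ , ext) = restriction π (proj₁ s) (fromℕ n)
                   (i , lr , v≡) = LastExtension.Unappend.unappend-isLRMax π σ ext s in
      (σ , i) , (LastExtension.Unappend.unappend-appendable π σ ext s , lr) , ext , v≡)
    (λ {(σ , i)} {π} {ρ} _ _ _ (ext , eq) (ext′ , eq′) →
      extension-unique π ρ (fromℕ n) σ ext ext′ (trans eq (sym eq′)))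
    (λ {(σ , i)} {(τ , h)} {π} (app , _) _ _ (ext , eq) (ext′ , eq′) →
      injective {σ} {τ} (proj₁ app) (restriction-unique π (fromℕ n) σ τ ext ext′)
        (Fin.inject₁-injective (trans (sym eq) eq′))))
  where
  injective : ∀ {σ τ : Vec (Fin n) n} {i h} → IsPerm σ → σ ≡ τ → lookup σ i ≡ lookup τ h → (σ , i) ≡ (τ , h)
  injective {σ} {i = i} {h} perm refl eq = cong (σ ,_) (perm i h eq)

-- A left-to-right maximum in last position carries the largest value, so deleting it loses no
-- information.
size-last-plain : ∀ n j → Size (λ π → Structured {suc n} j 1 π × PlainMax π (fromℕ n)) (countPerms n j 0)
size-last-plain n j = size-relate
  (λ σ π → Extends π (fromℕ n) σ × lookup π (fromℕ n) ≡ fromℕ n)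
  (size-structured n j 0)
  (λ {σ} s → let (π , ext , eq) = extension (fromℕ n) (fromℕ n) σ
                 plain = last-plain π (top {π} (Extension.extension-perm π (fromℕ n) σ ext (proj₁ s)) eq) in
    π , (PlainExtension.plain-structured π (fromℕ n) σ ext plain s , plain) , ext , eq)
  (λ {π} (s , plain) → let (σ , ext) = restriction π (proj₁ s) (fromℕ n) in
    σ , PlainExtension.plain-structured⁻ π (fromℕ n) σ ext plain s , ext , top⁻ {π} (proj₁ s) (proj₁ plain))
  (λ {σ} {π} {ρ} _ _ _ (ext , eq) (ext′ , eq′) → extension-unique π ρ (fromℕ n) σ ext ext′ (trans eq (sym eq′)))
  (λ {σ} {τ} {π} _ _ _ (ext , _) (ext′ , _) → restriction-unique π (fromℕ n) σ τ ext ext′)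
  where
  top : ∀ {π : Vec (Fin (suc n)) (suc n)} → IsPerm π → lookup π (fromℕ n) ≡ fromℕ n → IsLRMax π (fromℕ n)
  top {π} perm eq x lt = perm-≤⇒< π perm (<⇒≢ lt) (subst (lookup π x ≤_) (sym eq) (Fin.≤fromℕ _))
  top⁻ : ∀ {π : Vec (Fin (suc n)) (suc n)} → IsPerm π → IsLRMax π (fromℕ n) → lookup π (fromℕ n) ≡ fromℕ n
  top⁻ {π} perm lr with injective⇒surjective (lookup π) perm (fromℕ n)
  ... | x , eq with x Fin.≟ fromℕ n
  ... | yes refl = eq
  ... | no x≢last = ⊥-elim (last-max _ (subst (_< lookup π (fromℕ n)) eq (lr x (≢last⇒< x≢last))))

-- A plain maximum of an appendable permutation can only be the last entry. If the last entry is
-- one, the remaining `j` maxima descend; otherwise all `suc j` do.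
size-appendable : ∀ n j → Size (Appendable {suc n} (suc j)) (countPerms (suc n) (suc j) 0 + countPerms n j 0)
size-appendable n j = size-cong
  (λ {π} → [ closed {π} , (λ (s , plain) → open-ended {π} s plain) ])
  (λ {π} app → split {π} app (isLRMax? π (fromℕ n)))
  (size-⊎ (size-structured (suc n) (suc j) 0) (size-last-plain n j)
    (λ (_ , _ , _ , ps) (_ , plain) → size-0 ps plain))
  where
  closed : ∀ {π} → Structured {suc n} (suc j) 0 π → Appendable (suc j) π
  closed {π} (perm , sep , ds , ps) = perm , sep ,
    subst (Size (IsLRMax π)) (ℕ.+-identityʳ (suc j)) (size-isLRMax π perm ds ps) ,
    λ i plain → ⊥-elim (size-0 ps plain)
  open-ended : ∀ {π} → Structured {suc n} j 1 π → PlainMax π (fromℕ n) → Appendable (suc j) π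
  open-ended {π} (perm , sep , ds , ps) plain = perm , sep ,
    subst (Size (IsLRMax π)) (ℕ.+-comm j 1) (size-isLRMax π perm ds ps) ,
    λ i plainᵢ h lt → last-max h (subst (_< h) (size-1 ps plainᵢ plain) lt)
  split : ∀ {π} → Appendable (suc j) π → Dec (IsLRMax π (fromℕ n)) →
    Structured (suc j) 0 π ⊎ (Structured j 1 π × PlainMax π (fromℕ n))
  split {π} (perm , sep , ls , last) dec = go dec
    where
    only-last : ∀ {i} → PlainMax π i → fromℕ n ≡ i
    only-last {i} plain = decidable-stable (_ Fin.≟ _) (λ ne → last i plain (fromℕ n) (≢last⇒< (λ eq → ne (sym eq))))
    go : Dec (IsLRMax π (fromℕ n)) → _
    go (no ¬lr) = inj₁ (perm , sep , size-cong
      (λ {i} lr → decidable-stable (descentMax? π i) (λ ¬d → ¬plain (lr , ¬d)))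
      (descentMax⇒isLRMax π perm) ls , size-∅ ¬plain)
      where
      ¬plain : ∀ {i} → ¬ PlainMax π i
      ¬plain plain with only-last plain
      ... | refl = ¬lr (proj₁ plain)
    go (yes lr) = inj₂ ((perm , sep , subst (Size (DescentMax π)) count≡ (size-positions (descentMax? π)) , ps) , plain)
      where
      plain = last-plain π lr
      ps : Size (PlainMax π) 1
      ps = size-singleton plain only-last
      count≡ = ℕ.suc-injective (trans (ℕ.+-comm 1 _)
        (size-unique (size-isLRMax π perm (size-positions (descentMax? π)) ps) ls))

-- Recurrences and the closed formula

-- The first entry is always a left-to-right maximum, and it either descends or is plain.
count-no-maxima : ∀ n → countPerms (suc n) 0 0 ≡ 0
count-no-maxima n = size-unique (size-structured (suc n) 0 0) (size-∅ λ {π} (_ , _ , ds , ps) →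
  size-0 ps {zero} ((λ h ()) , size-0 ds))

count-empty-descents : ∀ j k → countPerms 0 (suc j) k ≡ 0
count-empty-descents j k = size-unique (size-structured 0 (suc j) k) (size-∅ λ (_ , _ , ds , _) →
  ℕ.1+n≢0 (size-unique ds (size-∅ λ {x} _ → Fin.¬Fin0 x)))

count-empty-plain : ∀ j k → countPerms 0 j (suc k) ≡ 0
count-empty-plain j k = size-unique (size-structured 0 j (suc k)) (size-∅ λ (_ , _ , _ , ps) →
  ℕ.1+n≢0 (size-unique ps (size-∅ λ {x} _ → Fin.¬Fin0 x)))

count-one-descents : ∀ j → countPerms 1 (suc j) 0 ≡ 0
count-one-descents j = append-step 0 (suc j) (size-∅ λ (_ , _ , ls , _) →
  ℕ.1+n≢0 (size-unique ls (size-∅ λ {x} _ → Fin.¬Fin0 x)))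

count-rec : ∀ n j → countPerms (2 + n) (suc j) 0 ≡ (countPerms (1 + n) (suc j) 0 + countPerms n j 0) * suc j
count-rec n j = append-step (suc n) (suc j) (size-appendable n j)

-- Separates the amount subtracted from `n` and the number of blocks, which the recurrences change
-- independently.
guardedStirling : ℕ → ℕ → ℕ → ℕ
guardedStirling n j i = if j ≤ᵇ n then stirling2 (n ∸ j) i else 0

-- The Stirling recurrence persists at the edge of the guard: for `j` equal to `suc n` the left side
-- is `stirling2 0 (suc i)`, which is 0 like the guarded right side.
guardedStirling-rec : ∀ n j i → guardedStirling (suc n) j (suc i) ≡ suc i * guardedStirling n j (suc i) + guardedStirling n j i
guardedStirling-rec n zero i = refl
guardedStirling-rec zero (suc zero) i = sym (trans (ℕ.+-identityʳ (i * 0)) (ℕ.*-zeroʳ i))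
guardedStirling-rec zero (suc (suc j)) i = sym (trans (ℕ.+-identityʳ (i * 0)) (ℕ.*-zeroʳ i))
guardedStirling-rec (suc n) (suc zero) i = refl
guardedStirling-rec (suc n) (suc (suc j)) i = guardedStirling-rec n (suc j) i

guardedStirling-suc : ∀ n j i → guardedStirling (suc n) (suc j) i ≡ guardedStirling n j i
guardedStirling-suc n zero i = refl
guardedStirling-suc n (suc j) i = refl

stirlingGuarded≡ : ∀ n j k → stirlingGuarded n j k ≡ guardedStirling n (j + k) j
stirlingGuarded≡ n j k = cong (λ m → if (j + k) ≤ᵇ n then stirling2 m j else 0) (ℕ.∸-+-assoc n j k)

-- `count-rec` reaches two sizes back, hence the separate cases for sizes 0 and 1. Its factor
-- `suc j` completes `j !` to `suc j !` in the second summand and supplies the Stirling coefficient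
-- in the first.
plain-free : ∀ n j → countPerms n j 0 ≡ j ! * guardedStirling n j j
plain-free zero zero = refl
plain-free zero (suc j) = trans (count-empty-descents j 0) (sym (ℕ.*-zeroʳ (suc j !)))
plain-free (suc n) zero = count-no-maxima n
plain-free (suc zero) (suc zero) = count-one-descents 0
plain-free (suc zero) (suc (suc j)) = trans (count-one-descents (suc j)) (sym (ℕ.*-zeroʳ (suc (suc j) !)))
plain-free (suc (suc n)) (suc j) = begin
  countPerms (2 + n) (suc j) 0
    ≡⟨ count-rec n j ⟩
  (countPerms (1 + n) (suc j) 0 + countPerms n j 0) * suc j
    ≡⟨ cong₂ (λ x y → (x + y) * suc j) (plain-free (suc n) (suc j)) (plain-free n j) ⟩
  (suc j ! * guardedStirling (suc n) (suc j) (suc j) + j ! * guardedStirling n j j) * suc j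
    ≡⟨ cong (λ x → (suc j ! * x + j ! * guardedStirling n j j) * suc j) (guardedStirling-suc n j (suc j)) ⟩
  (suc j ! * guardedStirling n j (suc j) + j ! * guardedStirling n j j) * suc j
    ≡⟨ rearrange j (j !) (guardedStirling n j (suc j)) (guardedStirling n j j) ⟩
  suc j ! * (suc j * guardedStirling n j (suc j) + guardedStirling n j j)
    ≡⟨ cong (suc j ! *_) (guardedStirling-rec n j j) ⟨
  suc j ! * guardedStirling (suc n) j (suc j)
    ≡⟨ cong (suc j ! *_) (guardedStirling-suc (suc n) j (suc j)) ⟨
  suc j ! * guardedStirling (2 + n) (suc j) (suc j) ∎
  where
  open ≡-Reasoning
  rearrange : ∀ j f s t → (suc j * f * s + f * t) * suc j ≡ suc j * f * (suc j * s + t)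
  rearrange = solve-∀

-- By Pascal's rule; it matches the factors `suc n` and `suc k` of `plain-step`.
absorption : ∀ n k → suc n * (n C k) ≡ (suc n C suc k) * suc k
absorption n zero = trans (ℕ.*-identityʳ (suc n)) (sym (trans (ℕ.*-identityʳ _) (nC1≡n (suc n))))
absorption zero (suc k) = refl
absorption (suc n) (suc k) = begin
  suc (suc n) * (suc n C suc k)
    ≡⟨ cong (λ x → (suc n C suc k) + suc n * x) (nCk+nC[k+1]≡[n+1]C[k+1] n k) ⟨
  (suc n C suc k) + suc n * ((n C k) + (n C suc k))
    ≡⟨ cong ((suc n C suc k) +_) (ℕ.*-distribˡ-+ (suc n) (n C k) (n C suc k)) ⟩
  (suc n C suc k) + (suc n * (n C k) + suc n * (n C suc k))
    ≡⟨ cong₂ (λ x y → (suc n C suc k) + (x + y)) (absorption n k) (absorption n (suc k)) ⟩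
  (suc n C suc k) + ((suc n C suc k) * suc k + (suc n C suc (suc k)) * suc (suc k))
    ≡⟨ rearrange (suc n C suc k) (suc n C suc (suc k)) k ⟩
  ((suc n C suc k) + (suc n C suc (suc k))) * suc (suc k)
    ≡⟨ cong (_* suc (suc k)) (nCk+nC[k+1]≡[n+1]C[k+1] (suc n) (suc k)) ⟩
  (suc (suc n) C suc (suc k)) * suc (suc k) ∎
  where
  open ≡-Reasoning
  rearrange : ∀ a b k → a + (a * suc k + b * suc (suc k)) ≡ (a + b) * suc (suc k)
  rearrange = solve-∀

-- Induction on `k`, cancelling the factor `suc k` that comes from the choice of a marked plain
-- maximum. Both `n` and `k` drop by one, so the argument of the Stirling number stays the same.
countPerms-formula : ∀ n j k → countPerms n j k ≡ (n C k) * (j ! * guardedStirling n (j + k) j)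
countPerms-formula n j zero = trans (plain-free n j)
  (trans (cong (λ m → j ! * guardedStirling n m j) (sym (ℕ.+-identityʳ j))) (sym (ℕ.*-identityˡ _)))
countPerms-formula zero j (suc k) = count-empty-plain j k
countPerms-formula (suc n) j (suc k) = ℕ.*-cancelʳ-≡ _ _ (suc k) (begin
  countPerms (suc n) j (suc k) * suc k
    ≡⟨ plain-step n j k ⟩
  suc n * countPerms n j k
    ≡⟨ cong (suc n *_) (countPerms-formula n j k) ⟩
  suc n * ((n C k) * (j ! * guardedStirling n (j + k) j))
    ≡⟨ ℕ.*-assoc (suc n) (n C k) _ ⟨
  suc n * (n C k) * (j ! * guardedStirling n (j + k) j)
    ≡⟨ cong₂ (λ x y → x * (j ! * y)) (absorption n k) (sym (guardedStirling-suc n (j + k) j)) ⟩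
  (suc n C suc k) * suc k * (j ! * guardedStirling (suc n) (suc (j + k)) j)
    ≡⟨ cong (λ m → (suc n C suc k) * suc k * (j ! * guardedStirling (suc n) m j)) (ℕ.+-suc j k) ⟨
  (suc n C suc k) * suc k * (j ! * guardedStirling (suc n) (j + suc k) j)
    ≡⟨ rearrange (suc n C suc k) (suc k) _ ⟩
  (suc n C suc k) * (j ! * guardedStirling (suc n) (j + suc k) j) * suc k ∎)
  where
  open ≡-Reasoning
  rearrange : ∀ a b c → a * b * c ≡ a * c * b
  rearrange = solve-∀

theorem1 : ∀ (n j k : ℕ) →
    countPerms n j k ≡ (n C k) * (j !) * stirlingGuarded n j k
theorem1 n j k = trans (countPerms-formula n j k)
  (trans (sym (ℕ.*-assoc (n C k) (j !) _)) (cong ((n C k) * j ! *_) (sym (stirlingGuarded≡ n j k))))
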